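{- Let $U=U_1\times\cdots\times U_m$ be a Cartesian product of nonempty finite sets. A set $S\subseteq U$ is ample if and only if $\chi(S\cap V)=1$ for every full-dimensional subproduct $V$ of $U$ with $S\cap V\neq\varnothing$.
   Context: A full-dimensional subproduct (also called a box) of $U$ is a set $V=V_1\times\cdots\times V_m$ with $\varnothing\neq V_i\subseteq U_i$. The dimension of a box $B=B_1\times\cdots\times B_m$ is $\dim(B)=\sum_{i=1}^m(|B_i|-1)$. For $T\subseteq U$, $f_i(T)$ denotes the number of boxes of dimension $i$ contained in $T$, and $\chi(T)=\sum_{i\ge 0}(-1)^if_i(T)$ is the Euler characteristic. A generalized partition of $U$ is a tuple $\Lambda=(\alpha_1,\dots,\alpha_m)$ with $\alpha_i$ a partition of $U_i$ into nonempty blocks; it defines a partition of $U$ into the boxes $P^1\times\cdots\times P^m$, $P^i\in\alpha_i$, and the minor-subproduct $M(\Lambda)=M_1\times\cdots\times M_m$, where $M_i$ is the set of blocks of $\alpha_i$. $M(\Lambda)$ is shattered by $S\subseteq U$ if $S$ meets every box of the box-partition. A copy of $M(\Lambda)$ is a set $W_1\times\cdots\times W_m$ where $W_i$ consists of exactly one element from each block of $\alpha_i$. $M(\Lambda)$ is strongly shattered by $S$ if $S$ contains a copy of it. $S$ is ample if every minor-subproduct of $U$ shattered by $S$ is strongly shattered by $S$. -}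

module Defs where

open import Data.Bool.Base using (true; false)
open import Data.Fin.Base using (Fin)
open import Data.Fin.Properties using (all?)
open import Data.Fin.Subset using (Subset; ⊤; ∣_∣; Nonempty) renaming (_∈_ to _∈ₛ_)
open import Data.Fin.Subset.Properties using (nonempty?) renaming (_∈?_ to _∈ₛ?_)
open import Data.Integer.Base using (ℤ; +_; 0ℤ; -1ℤ; _+_; _*_; _^_)
open import Data.List.Base using (List; [_]; length; filter; foldr; map; upTo; cartesianProductWith) renaming ([] to []ₗ; _∷_ to _∷ₗ_)
open import Data.Nat.Base using (ℕ; zero; suc; _∸_)
open import Data.Nat.Properties using (_≟_)
open import Data.Product.Base using (_×_; _,_; ∃-syntax)
open import Data.Product using (∃!)
open import Data.Vec.Base as Vec using (Vec; []; _∷_)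
open import Data.Vec.Relation.Unary.All using (All; []; _∷_)
open import Data.Vec.Relation.Unary.All.Properties using () renaming (lookup⁺ to lookupᵃ)
open import Level using (Level; 0ℓ)
open import Relation.Binary.PropositionalEquality using (_≡_)
open import Relation.Nullary.Decidable using (Dec; map′; _×-dec_; _→-dec_)
open import Relation.Unary using (Pred; Decidable; _⊆′_; _∩_; Satisfiable)

private
  variable
    m n : ℕ
    ns  : Vec ℕ m
    ℓ   : Level

-- U₁ × ⋯ × Uₘ with Uᵢ = Fin nᵢ.  Using All rather than dependent functions
-- keeps propositional equality of points extensional.
U : Vec ℕ m → Set
U ns = All Fin ns

-- A tuple of factors Vᵢ ⊆ Uᵢ, possibly empty.  When all factors are nonempty
-- the tuple is determined by its product, so counting tuples counts boxes.
Factors : Vec ℕ m → Set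
Factors ns = All Subset ns

IsBox : Factors ns → Set
IsBox V = ∀ i → Nonempty (lookupᵃ V i)

isBox? : Decidable (IsBox {ns = ns})
isBox? V = all? (λ i → nonempty? (lookupᵃ V i))

∏ : Factors ns → Pred (U ns) 0ℓ
∏ V x = ∀ i → lookupᵃ x i ∈ₛ lookupᵃ V i

∏? : (V : Factors ns) → Decidable (∏ V)
∏? V x = all? (λ i → lookupᵃ x i ∈ₛ? lookupᵃ V i)

dim : Factors ns → ℕ
dim B = Vec.sum (Vec.tabulate (λ i → ∣ lookupᵃ B i ∣ ∸ 1))

full : (ns : Vec ℕ m) → Factors ns
full []       = []
full (n ∷ ns) = ⊤ ∷ full ns

∀U? : {P : Pred (U ns) ℓ} → Decidable P → Dec (∀ x → P x)
∀U? {ns = []}     P? = map′ (λ { p [] → p }) (λ p → p []) (P? [])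
∀U? {ns = n ∷ ns} P? =
  map′ (λ { p (a ∷ x) → p a x }) (λ p a x → p (a ∷ x))
       (all? (λ a → ∀U? (λ x → P? (a ∷ x))))

∏⊆? : {T : Pred (U ns) ℓ} → Decidable T → (B : Factors ns) → Dec (∏ B ⊆′ T)
∏⊆? T? B = ∀U? (λ x → ∏? B x →-dec T? x)

subsets : (n : ℕ) → List (Subset n)
subsets zero    = [ [] ]
subsets (suc n) = cartesianProductWith _∷_ (true ∷ₗ false ∷ₗ []ₗ) (subsets n)

allFactors : (ns : Vec ℕ m) → List (Factors ns)
allFactors []       = [ [] ]
allFactors (n ∷ ns) = cartesianProductWith _∷_ (subsets n) (allFactors ns)

f : {T : Pred (U ns) ℓ} → ℕ → Decidable T → ℕ
f {ns = ns} i T? =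
  length (filter (λ B → isBox? B ×-dec (dim B ≟ i) ×-dec ∏⊆? T? B) (allFactors ns))

-- No box has dimension above dim (full ns), so the sum over all i ≥ 0 stops there.
χ : {T : Pred (U ns) ℓ} → Decidable T → ℤ
χ {ns = ns} T? =
  foldr _+_ 0ℤ (map (λ i → -1ℤ ^ i * + f i T?) (upTo (suc (dim (full ns)))))

-- Blocks are labelled by Fin size; the labels play no role in what follows.
record Partition (n : ℕ) : Set where
  field
    size     : ℕ
    block    : Fin size → Subset n
    nonempty : ∀ j → Nonempty (block j)
    covers   : ∀ x → ∃! _≡_ (λ j → x ∈ₛ block j)

open Partition public

GeneralizedPartition : Vec ℕ m → Set
GeneralizedPartition ns = All Partition ns

-- The minor-subproduct M(Λ): one block of αᵢ for each i.
Minor : {ns : Vec ℕ m} → GeneralizedPartition ns → Set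
Minor Λ = ∀ i → Fin (size (lookupᵃ Λ i))

cell : (Λ : GeneralizedPartition ns) → Minor Λ → Pred (U ns) 0ℓ
cell Λ P x = ∀ i → lookupᵃ x i ∈ₛ block (lookupᵃ Λ i) (P i)

Shattered : GeneralizedPartition ns → Pred (U ns) ℓ → Set ℓ
Shattered Λ S = ∀ P → Satisfiable (S ∩ cell Λ P)

-- Each block of αᵢ meets Wᵢ in exactly one element; as the blocks cover Uᵢ,
-- Wᵢ has no further elements.
IsCopy : GeneralizedPartition ns → Factors ns → Set
IsCopy Λ W =
  ∀ i j → ∃! _≡_ (λ a → a ∈ₛ block (lookupᵃ Λ i) j × a ∈ₛ lookupᵃ W i)

StronglyShattered : GeneralizedPartition ns → Pred (U ns) ℓ → Set ℓ
StronglyShattered Λ S = ∃[ W ] IsCopy Λ W × ∏ W ⊆′ S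

Ample : Pred (U ns) ℓ → Set ℓ
Ample S = ∀ Λ → Shattered Λ S → StronglyShattered Λ S

{-# OPTIONS --safe #-}

{- The signed sums over boxes B ⊆ S ∩ V are the values χ(S ∩ V).

χ = 1 ⇒ ample.  Let S shatter Λ.  For nonempty sets Fᵢ of blocks, the box V with
Vᵢ = ⋃ Fᵢ meets S, so the boxes B ⊆ S hitting only blocks in F have signed sum 1.
Möbius inversion over the Fᵢ shows that the boxes B ⊆ S hitting every block have
signed sum ±1; so there is such a B, and it contains a copy of M(Λ).

Ample ⇒ χ = 1.  Ampleness passes to intersections with boxes, so it suffices to
show χ(S) = 1 for S ≠ ∅.  Let S′ = ⋃ₐ Sₐ be the projection along the first factor,
again ample.  A box B′ ⊆ S′ lies in some slice Sₐ, because S ∩ (U₁ × B′) shatters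
the partition of B′ into points.  Hence the boxes of S over B′ correspond to the
nonempty subsets of a nonempty set, whose signed count is 1, and χ(S) = χ(S′). -}

module Submission where

open import Defs
open import Data.Bool.Base using (true; false; if_then_else_)
open import Data.Fin.Base using (Fin; zero; suc)
open import Data.Fin.Properties using (all?; any?; ¬∀⟶∃¬) renaming (_≟_ to _≟ᶠ_)
open import Data.Fin.Subset using (Subset; ⊤; ⊥; ∣_∣; Nonempty; _⊆_) renaming (_∈_ to _∈ₛ_; _∉_ to _∉ₛ_)
open import Data.Fin.Subset.Properties using (nonempty?; _⊆?_; ∈⊤; ∉⊥; out⊆; s⊆s; drop-∷-⊆; ∣⊤∣≡n; ∣p∣≤n)
  renaming (_∈?_ to _∈ₛ?_)
open import Data.Integer.Base using (ℤ; 0ℤ; 1ℤ; -1ℤ; _+_; _*_; -_; _-_; _^_) renaming (+_ to pos)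
open import Data.Integer.Properties using (+-identityˡ; +-identityʳ; +-assoc; +-inverseʳ; +-inverseˡ; *-identityˡ;
  *-zeroˡ; *-zeroʳ; -1*i≡-i; *-assoc; *-comm; *-distribʳ-+; *-distribˡ-+; neg-involutive; ^-distribˡ-+-*)
  renaming (_≟_ to _≟ᶻ_)
open import Data.Integer.Tactic.RingSolver using (solve-∀)
open import Data.List.Base using (List; []; _∷_; _++_; map; foldr; filter; length; upTo; applyUpTo; allFin;
  cartesianProductWith)
open import Data.List.Membership.Propositional.Properties using (∈-allFin)
open import Data.List.Relation.Unary.All as ListAll using ([]; _∷_) renaming (All to Allₗ)
import Data.List.Relation.Unary.All.Properties as ListAll
open import Data.Nat.Base as ℕ using (ℕ; zero; suc; NonZero; _∸_; s≤s; z≤n)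
import Data.Nat.Properties as ℕ
open import Data.Product.Base using (∃; _×_; _,_; proj₁; proj₂; uncurry)
open import Data.Sum.Base using (_⊎_; inj₁; inj₂; [_,_]′)
open import Data.Unit.Base using (tt) renaming (⊤ to Unit)
open import Data.Vec.Base using (Vec; lookup; tail; tabulate; here; there) renaming ([] to []ᵥ; _∷_ to _∷ᵥ_)
open import Data.Vec.Properties using ([]=⇒lookup; lookup⇒[]=; lookup∘tabulate)
open import Data.Vec.Relation.Unary.All using (All) renaming ([] to []ₐ; _∷_ to _∷ₐ_)
open import Data.Vec.Relation.Unary.All.Properties using (lookup⁻) renaming (lookup⁺ to lookupᵃ)
open import Function.Base using (id; _∘_; case_of_)
open import Function.Bundles using (_⇔_; mk⇔)
open import Level using (Level)
open import Relation.Binary.PropositionalEquality using (_≡_; _≢_; refl; sym; trans; cong; cong₂; subst; module ≡-Reasoning)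
open import Relation.Nullary using (¬_; Dec; yes; no; does; contradiction)
open import Relation.Nullary.Decidable using (_×-dec_; dec-true)
open import Relation.Unary using (Pred; Decidable; _∩_; Satisfiable; _⊆′_)
open import Relation.Unary.Properties using (_∩?_)

private
  variable
    a b p q r ℓ : Level
    A : Set a
    B : Set b
    P : Set p
    Q : Set q
    R : Set r
    m n : ℕ
    ns : Vec ℕ m

open ≡-Reasoning

-- Indicators and finite integer sums

⟦_⟧ : Dec P → ℤ
⟦ P? ⟧ = if does P? then 1ℤ else 0ℤ

⟦⟧-cong : (P? : Dec P) (Q? : Dec Q) → (P → Q) → (Q → P) → ⟦ P? ⟧ ≡ ⟦ Q? ⟧
⟦⟧-cong (yes _) (yes _) _ _ = refl
⟦⟧-cong (yes p) (no ¬q) f _ = contradiction (f p) ¬q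
⟦⟧-cong (no ¬p) (yes q) _ g = contradiction (g q) ¬p
⟦⟧-cong (no _)  (no _)  _ _ = refl

-- `R?` is a decision of its own, so that the product rule also splits `all?`, `_⊆?_` and `∏⊆?`,
-- which are not built by `_×-dec_`.
⟦⟧-× : (P? : Dec P) (Q? : Dec Q) (R? : Dec R) → (R → P × Q) → (P → Q → R) → ⟦ R? ⟧ ≡ ⟦ P? ⟧ * ⟦ Q? ⟧
⟦⟧-× (yes p) (yes q) R? f g = ⟦⟧-cong R? (yes (p , q)) f (uncurry g)
⟦⟧-× (yes p) (no ¬q) R? f g = ⟦⟧-cong R? (no ¬q) (proj₂ ∘ f) (g p)
⟦⟧-× (no ¬p) Q?      R? f g =
  trans (⟦⟧-cong R? (no ¬p) (proj₁ ∘ f) (λ p → contradiction p ¬p)) (sym (*-zeroˡ ⟦ Q? ⟧))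

⟦⟧-yes : (P? : Dec P) → P → ⟦ P? ⟧ ≡ 1ℤ
⟦⟧-yes P? p = ⟦⟧-cong P? (yes p) id id

⟦⟧-no : (P? : Dec P) → ¬ P → ⟦ P? ⟧ ≡ 0ℤ
⟦⟧-no P? ¬p = ⟦⟧-cong P? (no ¬p) id id

⟦⟧≢0⇒ : (P? : Dec P) → ⟦ P? ⟧ ≢ 0ℤ → P
⟦⟧≢0⇒ (yes p) _   = p
⟦⟧≢0⇒ (no _)  0≢0 = contradiction refl 0≢0

∑ : List A → (A → ℤ) → ℤ
∑ xs g = foldr _+_ 0ℤ (map g xs)

∑-cong : {g h : A → ℤ} (xs : List A) → (∀ x → g x ≡ h x) → ∑ xs g ≡ ∑ xs h
∑-cong []       g≗h = refl
∑-cong (x ∷ xs) g≗h = cong₂ _+_ (g≗h x) (∑-cong xs g≗h)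

∑-zero : {g : A → ℤ} (xs : List A) → (∀ x → g x ≡ 0ℤ) → ∑ xs g ≡ 0ℤ
∑-zero []       g≗0 = refl
∑-zero (x ∷ xs) g≗0 = trans (cong₂ _+_ (g≗0 x) (∑-zero xs g≗0)) refl

∑-+ : (g h : A → ℤ) (xs : List A) → ∑ xs (λ x → g x + h x) ≡ ∑ xs g + ∑ xs h
∑-+ g h []       = refl
∑-+ g h (x ∷ xs) = trans (cong ((g x + h x) +_) (∑-+ g h xs)) (lemma (g x) (h x) (∑ xs g) (∑ xs h))
  where
  lemma : ∀ i j k l → i + j + (k + l) ≡ i + k + (j + l)
  lemma = solve-∀

∑-* : (g : A → ℤ) (c : ℤ) (xs : List A) → ∑ xs (λ x → g x * c) ≡ ∑ xs g * c
∑-* g c []       = sym (*-zeroˡ c)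
∑-* g c (x ∷ xs) = trans (cong (g x * c +_) (∑-* g c xs)) (sym (*-distribʳ-+ c (g x) (∑ xs g)))

∑-*ˡ : (c : ℤ) (g : A → ℤ) (xs : List A) → ∑ xs (λ x → c * g x) ≡ c * ∑ xs g
∑-*ˡ c g []       = sym (*-zeroʳ c)
∑-*ˡ c g (x ∷ xs) = trans (cong (c * g x +_) (∑-*ˡ c g xs)) (sym (*-distribˡ-+ c (g x) (∑ xs g)))

∑-++ : (g : A → ℤ) (xs ys : List A) → ∑ (xs ++ ys) g ≡ ∑ xs g + ∑ ys g
∑-++ g []       ys = sym (+-identityˡ (∑ ys g))
∑-++ g (x ∷ xs) ys = trans (cong (g x +_) (∑-++ g xs ys)) (sym (+-assoc (g x) (∑ xs g) (∑ ys g)))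

∑-map : (g : B → ℤ) (h : A → B) (xs : List A) → ∑ (map h xs) g ≡ ∑ xs (g ∘ h)
∑-map g h []       = refl
∑-map g h (x ∷ xs) = cong (g (h x) +_) (∑-map g h xs)

∑-cartesianProductWith : {C : Set r} (g : C → ℤ) (h : A → B → C) (xs : List A) (ys : List B) →
  ∑ (cartesianProductWith h xs ys) g ≡ ∑ xs (λ x → ∑ ys (λ y → g (h x y)))
∑-cartesianProductWith g h []       ys = refl
∑-cartesianProductWith g h (x ∷ xs) ys =
  trans (∑-++ g (map (h x) ys) _) (cong₂ _+_ (∑-map g (h x) ys) (∑-cartesianProductWith g h xs ys))

∑-swap : (g : A → B → ℤ) (xs : List A) (ys : List B) →
  ∑ xs (λ x → ∑ ys (g x)) ≡ ∑ ys (λ y → ∑ xs (λ x → g x y))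
∑-swap g []       ys = sym (∑-zero ys (λ _ → refl))
∑-swap g (x ∷ xs) ys =
  trans (cong (∑ ys (g x) +_) (∑-swap g xs ys)) (sym (∑-+ (g x) (λ y → ∑ xs (λ x → g x y)) ys))

∑≢0⇒∃ : (g : A → ℤ) (xs : List A) → ∑ xs g ≢ 0ℤ → ∃ λ x → g x ≢ 0ℤ
∑≢0⇒∃ g []       ∑≢0 = contradiction refl ∑≢0
∑≢0⇒∃ g (x ∷ xs) ∑≢0 with g x ≟ᶻ 0ℤ
... | no gx≢0  = x , gx≢0
... | yes gx≡0 = ∑≢0⇒∃ g xs λ eq → ∑≢0 (cong₂ _+_ gx≡0 eq)

-- `upTo` unfolds to `applyUpTo` with a shifted function at each step, so the induction needs an
-- arbitrary `h`.
∑-applyUpTo-pick : ∀ (g : ℕ → ℤ) (h : ℕ → ℕ) N d v → d ℕ.< N → g (h d) ≡ v →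
  (∀ e → e ≢ d → g (h e) ≡ 0ℤ) → ∑ (applyUpTo h N) g ≡ v
∑-applyUpTo-pick g h (suc N) zero v _ hd he = begin
  g (h 0) + ∑ (applyUpTo (h ∘ suc) N) g ≡⟨ cong₂ _+_ hd (rest (h ∘ suc) N (λ e → he (suc e) λ ())) ⟩
  v + 0ℤ                                 ≡⟨ +-identityʳ v ⟩
  v                                      ∎
  where
  rest : ∀ h N → (∀ e → g (h e) ≡ 0ℤ) → ∑ (applyUpTo h N) g ≡ 0ℤ
  rest h zero    _  = refl
  rest h (suc N) h0 = cong₂ _+_ (h0 0) (rest (h ∘ suc) N (h0 ∘ suc))
∑-applyUpTo-pick g h (suc N) (suc d) v (s≤s d<N) hd he = trans
  (cong₂ _+_ (he 0 λ ()) (∑-applyUpTo-pick g (h ∘ suc) N d v d<N hd (λ e e≢d → he (suc e) (e≢d ∘ ℕ.suc-injective))))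
  (+-identityˡ v)

length-filter≡∑ : {P : Pred A p} (P? : Decidable P) (c : ℤ) (xs : List A) →
  c * pos (length (filter P? xs)) ≡ ∑ xs (λ x → c * ⟦ P? x ⟧)
length-filter≡∑ P? c []       = *-zeroʳ c
length-filter≡∑ P? c (x ∷ xs) with P? x
... | yes _ = trans (*-distribˡ-+ c 1ℤ _) (cong (c * 1ℤ +_) (length-filter≡∑ P? c xs))
... | no _  = trans (sym (+-identityˡ _)) (cong₂ _+_ (sym (*-zeroʳ c)) (length-filter≡∑ P? c xs))

-- Euler characteristic as a signed sum over boxes

-- `allFactors` also lists tuples with empty factors; the indicator gives them weight zero.
wt : Factors ns → ℤ
wt B = ⟦ isBox? B ⟧ * -1ℤ ^ dim B

dim≤dim-full : (B : Factors ns) → dim B ℕ.≤ dim (full ns)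
dim≤dim-full                []ₐ      = z≤n
dim≤dim-full {ns = n ∷ᵥ ns} (p ∷ₐ B) =
  ℕ.+-mono-≤ (ℕ.∸-monoˡ-≤ 1 (subst (∣ p ∣ ℕ.≤_) (sym (∣⊤∣≡n n)) (∣p∣≤n p))) (dim≤dim-full B)

module _ {ℓ} {T : Pred (U ns) ℓ} (T? : Decidable T) where

  private
    term : ℕ → Factors ns → ℤ
    term i B = -1ℤ ^ i * ⟦ isBox? B ×-dec (dim B ℕ.≟ i) ×-dec ∏⊆? T? B ⟧

    -- A box is counted only at `i = dim B`, which the range reaches by `dim≤dim-full`.
    ∑-term : ∀ B → ∑ (upTo (suc (dim (full ns)))) (λ i → term i B) ≡ wt B * ⟦ ∏⊆? T? B ⟧
    ∑-term B = ∑-applyUpTo-pick (λ i → term i B) id _ (dim B) _ (s≤s (dim≤dim-full B)) at-dim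
      (λ e e≢d → trans (cong (-1ℤ ^ e *_)
        (⟦⟧-no (isBox? B ×-dec (dim B ℕ.≟ e) ×-dec ∏⊆? T? B) λ (_ , d≡e , _) → e≢d (sym d≡e))) (*-zeroʳ (-1ℤ ^ e)))
      where
      at-dim : term (dim B) B ≡ wt B * ⟦ ∏⊆? T? B ⟧
      at-dim = trans
        (cong (-1ℤ ^ dim B *_) (⟦⟧-× (isBox? B) (∏⊆? T? B) (isBox? B ×-dec (dim B ℕ.≟ dim B) ×-dec ∏⊆? T? B)
          (λ (b , _ , c) → b , c) (λ b c → b , refl , c)))
        (rearrange (-1ℤ ^ dim B) ⟦ isBox? B ⟧ ⟦ ∏⊆? T? B ⟧)
        where
        rearrange : ∀ x y z → x * (y * z) ≡ y * x * z
        rearrange = solve-∀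

  χ≡∑ : χ T? ≡ ∑ (allFactors ns) (λ B → wt B * ⟦ ∏⊆? T? B ⟧)
  χ≡∑ = begin
    χ T?
      ≡⟨ ∑-cong (upTo (suc (dim (full ns)))) (λ i →
           length-filter≡∑ (λ B → isBox? B ×-dec (dim B ℕ.≟ i) ×-dec ∏⊆? T? B) (-1ℤ ^ i) (allFactors ns)) ⟩
    ∑ (upTo (suc (dim (full ns)))) (λ i → ∑ (allFactors ns) (term i))
      ≡⟨ ∑-swap term (upTo (suc (dim (full ns)))) (allFactors ns) ⟩
    ∑ (allFactors ns) (λ B → ∑ (upTo (suc (dim (full ns)))) (λ i → term i B))
      ≡⟨ ∑-cong (allFactors ns) ∑-term ⟩
    ∑ (allFactors ns) (λ B → wt B * ⟦ ∏⊆? T? B ⟧) ∎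

-- Möbius inversion

-- mob k u w is the value at ⊤ of the function on subsets of a k-set whose
-- sums over the subsets of F are u for nonempty F and w for F = ∅.
mob : ℕ → ℤ → ℤ → ℤ
mob zero    u w = w
mob (suc k) u w = mob k 0ℤ (u - w)

-- The first step turns the pair `u`, `0ℤ` into `0ℤ`, `u`; every later step only changes the sign of
-- the second entry, so the value is `u` up to sign.
mob≢0 : ∀ {k} u → u ≢ 0ℤ → Fin k → mob k u 0ℤ ≢ 0ℤ
mob≢0 {suc k} u u≢0 _ = from-zero k (u - 0ℤ) (subst (_≢ 0ℤ) (sym (+-identityʳ u)) u≢0)
  where
  from-zero : ∀ k w → w ≢ 0ℤ → mob k 0ℤ w ≢ 0ℤ
  from-zero zero    w w≢0 = w≢0
  from-zero (suc k) w w≢0 = from-zero k (0ℤ - w) λ eq →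
    w≢0 (trans (sym (neg-involutive w)) (cong -_ (trans (sym (+-identityˡ (- w))) eq)))

-- Induction on `k`. Requiring `zero ∈ₛ q x` is inclusion-exclusion in one element: the sum for
-- `true ∷ᵥ F` minus that for `false ∷ᵥ F`. This is `u - u` for nonempty `F` and `u - w` for `⊥`,
-- the two arguments in the recursion of `mob`.
∑-mob : ∀ {k} (xs : List A) (q : A → Subset k) (h : A → ℤ) {u w} →
  (∀ F → Nonempty F → ∑ xs (λ x → h x * ⟦ q x ⊆? F ⟧) ≡ u) →
  ∑ xs (λ x → h x * ⟦ q x ⊆? ⊥ ⟧) ≡ w →
  ∑ xs (λ x → h x * ⟦ ⊤ ⊆? q x ⟧) ≡ mob k u w
-- For `k = 0` the subsets `⊤` and `⊥` coincide.
∑-mob {k = zero} xs q h _ ∑⊥ = trans (∑-cong xs (λ x → cong (h x *_) (trivial (q x)))) ∑⊥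
  where
  trivial : (p : Subset 0) → ⟦ ⊤ ⊆? p ⟧ ≡ ⟦ p ⊆? ⊥ ⟧
  trivial []ᵥ = refl
∑-mob {A = A} {k = suc k} xs q h {u} {w} ∑F ∑⊥ = begin
  ∑ xs (λ x → h x * ⟦ ⊤ ⊆? q x ⟧)
    ≡⟨ ∑-cong xs (λ x → trans (cong (h x *_) (⊤-split (q x))) (sym (*-assoc (h x) _ _))) ⟩
  ∑ xs (λ x → h′ x * ⟦ ⊤ ⊆? q′ x ⟧)
    ≡⟨ ∑-mob xs q′ h′ (λ F F≠∅ → trans (difference F)
         (trans (cong₂ _-_ (∑F (true ∷ᵥ F) (zero , here)) (∑F (false ∷ᵥ F) (let i , i∈F = F≠∅ in suc i , there i∈F)))
                (+-inverseʳ u)))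
       (trans (difference ⊥) (cong₂ _-_ (∑F (true ∷ᵥ ⊥) (zero , here)) ∑⊥)) ⟩
  mob k 0ℤ (u - w) ∎
  where
  h′ : A → ℤ
  h′ x = h x * ⟦ zero ∈ₛ? q x ⟧

  q′ : A → Subset k
  q′ x = tail (q x)

  ⊤-split : (p : Subset (suc k)) → ⟦ ⊤ ⊆? p ⟧ ≡ ⟦ zero ∈ₛ? p ⟧ * ⟦ ⊤ ⊆? tail p ⟧
  ⊤-split p@(b ∷ᵥ p′) = ⟦⟧-× (zero ∈ₛ? p) (⊤ ⊆? p′) (⊤ ⊆? p)
    (λ ⊤⊆p → ⊤⊆p here , drop-∷-⊆ ⊤⊆p) (λ { here ⊤⊆p′ → s⊆s ⊤⊆p′ })

  split : (p : Subset (suc k)) (F : Subset k) →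
    ⟦ zero ∈ₛ? p ⟧ * ⟦ tail p ⊆? F ⟧ ≡ ⟦ p ⊆? (true ∷ᵥ F) ⟧ - ⟦ p ⊆? (false ∷ᵥ F) ⟧
  split p@(true ∷ᵥ p′) F = begin
    1ℤ * ⟦ p′ ⊆? F ⟧
      ≡⟨ *-identityˡ _ ⟩
    ⟦ p′ ⊆? F ⟧
      ≡⟨ ⟦⟧-cong (p′ ⊆? F) (p ⊆? (true ∷ᵥ F)) s⊆s drop-∷-⊆ ⟩
    ⟦ p ⊆? (true ∷ᵥ F) ⟧
      ≡⟨ +-identityʳ _ ⟨
    ⟦ p ⊆? (true ∷ᵥ F) ⟧ - 0ℤ
      ≡⟨ cong (λ z → ⟦ p ⊆? (true ∷ᵥ F) ⟧ - z)
           (⟦⟧-no (p ⊆? (false ∷ᵥ F)) λ p⊆ → case p⊆ here of λ ()) ⟨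
    ⟦ p ⊆? (true ∷ᵥ F) ⟧ - ⟦ p ⊆? (false ∷ᵥ F) ⟧ ∎
  split p@(false ∷ᵥ p′) F = sym (begin
    ⟦ p ⊆? (true ∷ᵥ F) ⟧ - ⟦ p ⊆? (false ∷ᵥ F) ⟧
      ≡⟨ cong (_- ⟦ p ⊆? (false ∷ᵥ F) ⟧) (⟦⟧-cong (p ⊆? (true ∷ᵥ F)) (p ⊆? (false ∷ᵥ F))
           (λ p⊆ → out⊆ (drop-∷-⊆ p⊆)) (λ p⊆ → out⊆ (drop-∷-⊆ p⊆))) ⟩
    ⟦ p ⊆? (false ∷ᵥ F) ⟧ - ⟦ p ⊆? (false ∷ᵥ F) ⟧
      ≡⟨ +-inverseʳ ⟦ p ⊆? (false ∷ᵥ F) ⟧ ⟩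
    0ℤ ∎)

  difference : ∀ F → ∑ xs (λ x → h′ x * ⟦ q′ x ⊆? F ⟧) ≡
    ∑ xs (λ x → h x * ⟦ q x ⊆? (true ∷ᵥ F) ⟧) - ∑ xs (λ x → h x * ⟦ q x ⊆? (false ∷ᵥ F) ⟧)
  difference F = begin
    ∑ xs (λ x → h′ x * ⟦ q′ x ⊆? F ⟧)
      ≡⟨ ∑-cong xs (λ x → trans (*-assoc (h x) _ _) (trans (cong (h x *_) (split (q x) F)) (expand (h x) _ _))) ⟩
    ∑ xs (λ x → h x * ⟦ q x ⊆? (true ∷ᵥ F) ⟧ + h x * ⟦ q x ⊆? (false ∷ᵥ F) ⟧ * -1ℤ)
      ≡⟨ ∑-+ _ _ xs ⟩
    S₁ + ∑ xs (λ x → h x * ⟦ q x ⊆? (false ∷ᵥ F) ⟧ * -1ℤ)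
      ≡⟨ cong (S₁ +_) (trans (∑-* _ -1ℤ xs) (trans (*-comm S₀ -1ℤ) (-1*i≡-i S₀))) ⟩
    S₁ - S₀ ∎
    where
    S₁ = ∑ xs (λ x → h x * ⟦ q x ⊆? (true ∷ᵥ F) ⟧)
    S₀ = ∑ xs (λ x → h x * ⟦ q x ⊆? (false ∷ᵥ F) ⟧)
    expand : ∀ x y z → x * (y - z) ≡ x * y + x * z * -1ℤ
    expand = solve-∀

module _ {A : Set a} (xs : List A) where

  -- Inversion in one coordinate at a time. For coordinate `zero`, the conditions on the others are
  -- folded into the weight and `∑-mob` applies with `w = 0ℤ` by `van`. Then `⊤ ⊆ q zero x` joins
  -- the weight, and the induction goes on with `mob (k zero) u 0ℤ`, again nonzero, in place of `u`.
  ∑-mob-product : ∀ m {k : Fin m → ℕ} → (∀ i → Fin (k i)) →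
    (q : ∀ i → A → Subset (k i)) (h : A → ℤ) {u : ℤ} → u ≢ 0ℤ →
    (∀ i x → h x * ⟦ q i x ⊆? ⊥ ⟧ ≡ 0ℤ) →
    (∀ (F : ∀ i → Subset (k i)) → (∀ i → Nonempty (F i)) → ∑ xs (λ x → h x * ⟦ all? (λ i → q i x ⊆? F i) ⟧) ≡ u) →
    ∑ xs (λ x → h x * ⟦ all? (λ i → ⊤ ⊆? q i x) ⟧) ≢ 0ℤ
  ∑-mob-product zero pts q h u≢0 van ∑F = subst (_≢ 0ℤ) (sym (∑F (λ ()) (λ ()))) u≢0
  ∑-mob-product (suc m) {k} pts q h {u} u≢0 van ∑F =
    subst (_≢ 0ℤ) (∑-cong xs (λ x → trans (*-assoc (h x) _ _) (cong (h x *_) (sym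
      (⟦⟧-× (⊤ ⊆? q zero x) (all? (λ i → ⊤ ⊆? q (suc i) x)) (all? (λ i → ⊤ ⊆? q i x))
        (λ ⊤⊆ → ⊤⊆ zero , ⊤⊆ ∘ suc) (λ { p ps zero → p ; p ps (suc i) → ps i }))))))
    (∑-mob-product m (pts ∘ suc) (q ∘ suc) h′ (mob≢0 u u≢0 (pts zero))
      (λ i x → vanish (h x) ⟦ ⊤ ⊆? q zero x ⟧ (van (suc i) x))
      (λ F F≠∅ → trans (∑-cong xs (λ x → swap (h x) _ _))
        (∑-mob xs (q zero) (λ x → h x * ⟦ all? (λ i → q (suc i) x ⊆? F i) ⟧)
          (λ F₀ F₀≠∅ → trans (∑-cong xs (λ x → merge F F₀ x)) (∑F (cons F₀ F) λ { zero → F₀≠∅ ; (suc i) → F≠∅ i }))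
          (∑-zero xs λ x → vanish (h x) ⟦ all? (λ i → q (suc i) x ⊆? F i) ⟧ (van zero x)))))
    where
    h′ : A → ℤ
    h′ x = h x * ⟦ ⊤ ⊆? q zero x ⟧

    swap : ∀ x y z → x * y * z ≡ x * z * y
    swap = solve-∀

    vanish : ∀ x y {z} → x * z ≡ 0ℤ → x * y * z ≡ 0ℤ
    vanish x y {z} xz≡0 = trans (swap x y z) (trans (cong (_* y) xz≡0) (*-zeroˡ y))

    cons : Subset (k zero) → (∀ i → Subset (k (suc i))) → ∀ i → Subset (k i)
    cons F₀ F zero    = F₀
    cons F₀ F (suc i) = F i

    merge : ∀ F F₀ x → h x * ⟦ all? (λ i → q (suc i) x ⊆? F i) ⟧ * ⟦ q zero x ⊆? F₀ ⟧ ≡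
      h x * ⟦ all? (λ i → q i x ⊆? cons F₀ F i) ⟧
    merge F F₀ x = trans (*-assoc (h x) _ _) (cong (h x *_) (sym
      (⟦⟧-× (all? (λ i → q (suc i) x ⊆? F i)) (q zero x ⊆? F₀) (all? (λ i → q i x ⊆? cons F₀ F i))
        (λ ps → ps ∘ suc , ps zero) (λ { ps p zero → p ; ps p (suc i) → ps i }))))

-- Subsets from decidable predicates, images and preimages

module _ {P : Pred (Fin n) p} (P? : Decidable P) where

  comprehension : Subset n
  comprehension = tabulate (λ a → does (P? a))

  ∈-comprehension⁺ : ∀ {a} → P a → a ∈ₛ comprehension
  ∈-comprehension⁺ {a} Pa = lookup⇒[]= a comprehension (trans (lookup∘tabulate _ a) (dec-true (P? a) Pa))

  ∈-comprehension⁻ : ∀ {a} → a ∈ₛ comprehension → P a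
  ∈-comprehension⁻ {a} a∈ = does-true (P? a) (trans (sym (lookup∘tabulate _ a)) ([]=⇒lookup a∈))
    where
    does-true : {Q : Set p} (Q? : Dec Q) → does Q? ≡ true → Q
    does-true (yes p) _ = p

module _ (ns : Vec ℕ m) (V : ∀ i → Subset (lookup ns i)) where

  factors : Factors ns
  factors = lookup⁻ V

  lookup-factors : ∀ i → lookupᵃ factors i ≡ V i
  lookup-factors = go ns V
    where
    go : ∀ {m} (ns : Vec ℕ m) (V : ∀ i → Subset (lookup ns i)) i → lookupᵃ {P = Subset} {xs = ns} (lookup⁻ V) i ≡ V i
    go (_ ∷ᵥ _)  V zero    = refl
    go (_ ∷ᵥ ns) V (suc i) = go ns (V ∘ suc) i

  ∈-factors⁺ : ∀ i {a} → a ∈ₛ V i → a ∈ₛ lookupᵃ factors i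
  ∈-factors⁺ i = subst (_ ∈ₛ_) (sym (lookup-factors i))

  ∈-factors⁻ : ∀ i {a} → a ∈ₛ lookupᵃ factors i → a ∈ₛ V i
  ∈-factors⁻ i = subst (_ ∈ₛ_) (lookup-factors i)

module _ {n k} (c : Fin n → Fin k) where

  image : Subset n → Subset k
  image p = comprehension (λ j → any? (λ a → (a ∈ₛ? p) ×-dec (c a ≟ᶠ j)))

  preimage : Subset k → Subset n
  preimage F = comprehension (λ a → c a ∈ₛ? F)

  ∈-image⁺ : ∀ {p a} → a ∈ₛ p → c a ∈ₛ image p
  ∈-image⁺ {p} {a} a∈p = ∈-comprehension⁺ (λ j → any? (λ a → (a ∈ₛ? p) ×-dec (c a ≟ᶠ j))) (a , a∈p , refl)

  ∈-image⁻ : ∀ {p j} → j ∈ₛ image p → ∃ λ a → a ∈ₛ p × c a ≡ j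
  ∈-image⁻ {p} = ∈-comprehension⁻ (λ j → any? (λ a → (a ∈ₛ? p) ×-dec (c a ≟ᶠ j)))

  ∈-preimage⁺ : ∀ {F a} → c a ∈ₛ F → a ∈ₛ preimage F
  ∈-preimage⁺ {F} = ∈-comprehension⁺ (λ a → c a ∈ₛ? F)

  ∈-preimage⁻ : ∀ {F a} → a ∈ₛ preimage F → c a ∈ₛ F
  ∈-preimage⁻ {F} = ∈-comprehension⁻ (λ a → c a ∈ₛ? F)

-- Points of boxes and vanishing weights

IsBox-point : (B : Factors ns) → IsBox B → ∃ λ x → ∏ B x
IsBox-point []ₐ      box = []ₐ , λ ()
IsBox-point (p ∷ₐ B) box =
  let a , a∈p = box zero ; x , x∈B = IsBox-point B (box ∘ suc) in
  (a ∷ₐ x) , λ { zero → a∈p ; (suc i) → x∈B i }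

-- Serves to read a property of single factors off an inclusion of products, which works because the
-- remaining factors are nonempty.
IsBox-point-through : (B : Factors ns) → IsBox B → ∀ i {a} → a ∈ₛ lookupᵃ B i →
  ∃ λ x → ∏ B x × lookupᵃ x i ≡ a
IsBox-point-through (p ∷ₐ B) box zero {a} a∈p =
  let x , x∈B = IsBox-point B (box ∘ suc) in
  (a ∷ₐ x) , (λ { zero → a∈p ; (suc i) → x∈B i }) , refl
IsBox-point-through (p ∷ₐ B) box (suc i) a∈ =
  let x , x∈B , xᵢ≡a = IsBox-point-through B (box ∘ suc) i a∈ ; b , b∈p = box zero in
  (b ∷ₐ x) , (λ { zero → b∈p ; (suc i) → x∈B i }) , xᵢ≡a

⟦⟧*-cong : (P? : Dec P) (c : ℤ) {x y : ℤ} → (P → x ≡ y) → ⟦ P? ⟧ * c * x ≡ ⟦ P? ⟧ * c * y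
⟦⟧*-cong (yes p) c         x≡y = cong (1ℤ * c *_) (x≡y p)
⟦⟧*-cong (no _)  c {x} {y} _   = trans (vanish x) (sym (vanish y))
  where
  vanish : ∀ z → 0ℤ * c * z ≡ 0ℤ
  vanish z = trans (cong (_* z) (*-zeroˡ c)) (*-zeroˡ z)

-- Off boxes the weight is zero, so summands may be compared as if all tuples were boxes.
wt-cong : (B : Factors ns) {x y : ℤ} → (IsBox B → x ≡ y) → wt B * x ≡ wt B * y
wt-cong B = ⟦⟧*-cong (isBox? B) (-1ℤ ^ dim B)

*≢0⇒≢0ˡ : ∀ x {y} → x * y ≢ 0ℤ → x ≢ 0ℤ
*≢0⇒≢0ˡ x {y} xy≢0 x≡0 = xy≢0 (trans (cong (_* y) x≡0) (*-zeroˡ y))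

*≢0⇒≢0ʳ : ∀ x {y} → x * y ≢ 0ℤ → y ≢ 0ℤ
*≢0⇒≢0ʳ x xy≢0 y≡0 = xy≢0 (trans (cong (x *_) y≡0) (*-zeroʳ x))

-- Euler characteristic 1 implies ampleness

module _ (α : Partition n) where

  blockOf : Fin n → Fin (size α)
  blockOf a = proj₁ (covers α a)

  ∈-blockOf : ∀ a → a ∈ₛ block α (blockOf a)
  ∈-blockOf a = proj₁ (proj₂ (covers α a))

  ∈-block⇒blockOf : ∀ {a j} → a ∈ₛ block α j → blockOf a ≡ j
  ∈-block⇒blockOf {a} a∈ = proj₂ (proj₂ (covers α a)) a∈

module _ {ℓ} {ns : Vec ℕ m} (nonZero : ∀ i → NonZero (lookup ns i)) {S : Pred (U ns) ℓ} (S? : Decidable S)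
         (χ≡1 : (V : Factors ns) → IsBox V → Satisfiable (S ∩ ∏ V) → χ (S? ∩? ∏? V) ≡ 1ℤ) where

  χ≡1⇒Ample : Ample S
  χ≡1⇒Ample Λ shattered = W , copy , W⊆S
    where
    c : ∀ i → Fin (lookup ns i) → Fin (size (lookupᵃ Λ i))
    c i = blockOf (lookupᵃ Λ i)

    hit : ∀ i → Factors ns → Subset (size (lookupᵃ Λ i))
    hit i B = image (c i) (lookupᵃ B i)

    h : Factors ns → ℤ
    h B = wt B * ⟦ ∏⊆? S? B ⟧

    -- Each partition has a block because its factor is nonempty; with no blocks, `mob 0 u 0ℤ` would
    -- be zero.
    label₀ : ∀ i → Fin (size (lookupᵃ Λ i))
    label₀ i with lookup ns i | nonZero i | c i
    ... | suc _ | _ | cᵢ = cᵢ zero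

    -- Every factor of a box hits at least one block.
    h-⊥ : ∀ i B → h B * ⟦ hit i B ⊆? ⊥ ⟧ ≡ 0ℤ
    h-⊥ i B = trans (*-assoc (wt B) _ _) (trans
      (wt-cong B {y = 0ℤ} λ box → trans
        (cong (⟦ ∏⊆? S? B ⟧ *_) (⟦⟧-no (hit i B ⊆? ⊥) λ q⊆⊥ →
          let a , a∈B = box i in ∉⊥ (q⊆⊥ (∈-image⁺ (c i) a∈B))))
        (*-zeroʳ ⟦ ∏⊆? S? B ⟧))
      (*-zeroʳ (wt B)))

    -- A box lies in `S ∩ ∏ V`, with `V` the union of the blocks in `F`, exactly when it lies in `S`
    -- and hits only blocks in `F`.
    sum-over-preimage : (F : ∀ i → Subset (size (lookupᵃ Λ i))) → (∀ i → Nonempty (F i)) →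
      ∑ (allFactors ns) (λ B → h B * ⟦ all? (λ i → hit i B ⊆? F i) ⟧) ≡ 1ℤ
    sum-over-preimage F F≠∅ = begin
      ∑ (allFactors ns) (λ B → h B * ⟦ all? (λ i → hit i B ⊆? F i) ⟧)
        ≡⟨ ∑-cong (allFactors ns) (λ B → trans (*-assoc (wt B) _ _) (wt-cong B λ box → sym
             (⟦⟧-× (∏⊆? S? B) (all? (λ i → hit i B ⊆? F i)) (∏⊆? (S? ∩? ∏? V) B) (to B box) (from B)))) ⟩
      ∑ (allFactors ns) (λ B → wt B * ⟦ ∏⊆? (S? ∩? ∏? V) B ⟧)
        ≡⟨ χ≡∑ (S? ∩? ∏? V) ⟨
      χ (S? ∩? ∏? V)
        ≡⟨ χ≡1 V (λ i → _ , proj₂ meets i) (proj₁ (shattered (proj₁ ∘ F≠∅)) , proj₁ meets , proj₂ meets) ⟩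
      1ℤ ∎
      where
      V : Factors ns
      V = factors ns (λ i → preimage (c i) (F i))

      ∈V⁺ : ∀ i {a} → c i a ∈ₛ F i → a ∈ₛ lookupᵃ V i
      ∈V⁺ i ca∈F = ∈-factors⁺ ns (λ i → preimage (c i) (F i)) i (∈-preimage⁺ (c i) ca∈F)

      ∈V⁻ : ∀ i {a} → a ∈ₛ lookupᵃ V i → c i a ∈ₛ F i
      ∈V⁻ i a∈V = ∈-preimage⁻ (c i) (∈-factors⁻ ns (λ i → preimage (c i) (F i)) i a∈V)

      -- One block is picked from each `F i`, and shattering gives a point of `S` in their cell. Its
      -- coordinates also show that `V` is a box.
      meets : S (proj₁ (shattered (proj₁ ∘ F≠∅))) × ∏ V (proj₁ (shattered (proj₁ ∘ F≠∅)))
      meets = let x , Sx , x∈cell = shattered (proj₁ ∘ F≠∅) in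
        Sx , λ i → ∈V⁺ i (subst (_∈ₛ F i) (sym (∈-block⇒blockOf (lookupᵃ Λ i) (x∈cell i))) (proj₂ (F≠∅ i)))

      to : ∀ B → IsBox B → ∏ B ⊆′ (S ∩ ∏ V) → ∏ B ⊆′ S × (∀ i → hit i B ⊆ F i)
      to B box B⊆ = (λ x x∈B → proj₁ (B⊆ x x∈B)) , λ i {j} j∈q →
        let a , a∈B , ca≡j = ∈-image⁻ (c i) j∈q
            x , x∈B , xᵢ≡a = IsBox-point-through B box i a∈B
        in subst (_∈ₛ F i) (trans (cong (c i) xᵢ≡a) ca≡j) (∈V⁻ i (proj₂ (B⊆ x x∈B) i))

      from : ∀ B → ∏ B ⊆′ S → (∀ i → hit i B ⊆ F i) → ∏ B ⊆′ (S ∩ ∏ V)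
      from B B⊆S q⊆F x x∈B = B⊆S x x∈B , λ i → ∈V⁺ i (q⊆F i (∈-image⁺ (c i) (x∈B i)))

    -- A nonzero sum has a nonzero summand, and there both indicators must be 1.
    hitting : ∃ λ B → ∏ B ⊆′ S × (∀ i → ⊤ ⊆ hit i B)
    hitting =
      let B , hB≢0 = ∑≢0⇒∃ _ (allFactors ns)
            (∑-mob-product (allFactors ns) m label₀ hit h {1ℤ} (λ ()) h-⊥ sum-over-preimage)
      in B ,
         ⟦⟧≢0⇒ (∏⊆? S? B) (*≢0⇒≢0ʳ (wt B) (*≢0⇒≢0ˡ (h B) hB≢0)) ,
         ⟦⟧≢0⇒ (all? (λ i → ⊤ ⊆? hit i B)) (*≢0⇒≢0ʳ (h B) hB≢0)

    B₀ : Factors ns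
    B₀ = proj₁ hitting

    choice : ∀ i j → ∃ λ a → a ∈ₛ lookupᵃ B₀ i × c i a ≡ j
    choice i j = ∈-image⁻ (c i) (proj₂ (proj₂ hitting) i ∈⊤)

    w : ∀ i → Fin (size (lookupᵃ Λ i)) → Fin (lookup ns i)
    w i j = proj₁ (choice i j)

    -- Since `c i ∘ w i` is the identity, the fixed points of `w i ∘ c i` are the image of `w i`;
    -- membership is one equality test.
    chosen? : ∀ i → Decidable (λ a → w i (c i a) ≡ a)
    chosen? i a = w i (c i a) ≟ᶠ a

    W : Factors ns
    W = factors ns (λ i → comprehension (chosen? i))

    ∈W⁻ : ∀ i {a} → a ∈ₛ lookupᵃ W i → w i (c i a) ≡ a
    ∈W⁻ i a∈W = ∈-comprehension⁻ (chosen? i) (∈-factors⁻ ns (λ i → comprehension (chosen? i)) i a∈W)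

    copy : IsCopy Λ W
    copy i j =
      w i j ,
      ( subst (λ j′ → w i j ∈ₛ block (lookupᵃ Λ i) j′) cw≡j (∈-blockOf (lookupᵃ Λ i) (w i j))
      , ∈-factors⁺ ns (λ i → comprehension (chosen? i)) i (∈-comprehension⁺ (chosen? i) (cong (w i) cw≡j)) ) ,
      λ { (a∈block , a∈W) → trans (cong (w i) (sym (∈-block⇒blockOf (lookupᵃ Λ i) a∈block))) (∈W⁻ i a∈W) }
      where
      cw≡j : c i (w i j) ≡ j
      cw≡j = proj₂ (proj₂ (choice i j))

    W⊆S : ∏ W ⊆′ S
    W⊆S x x∈W = proj₁ (proj₂ hitting) x λ i →
      subst (_∈ₛ lookupᵃ B₀ i) (∈W⁻ i (x∈W i)) (proj₁ (proj₂ (choice i (c i (lookupᵃ x i)))))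

-- Shattering of labellings

-- Labellings replace partitions, whose blocks are the fibres. Surjectivity is not built in, so
-- labellings can be merged and split freely; shattering forces it once `U ns` has a point.
Labels : Vec ℕ m → Set
Labels ns = All (λ n → ∃ λ k → Fin n → Fin k) ns

-- Recursion on the factors suits projection along the first one. Here the coordinate `a` may depend
-- on all labels; in `StronglyShatters` it is `w j`, depending on its own label only, which makes
-- the copy a product.
Shatters : Labels ns → Pred (U ns) ℓ → Set ℓ
Shatters []ₐ            S = S []ₐ
Shatters ((k , c) ∷ₐ L) S = ∀ j → Shatters L (λ x → ∃ λ a → c a ≡ j × S (a ∷ₐ x))

StronglyShatters : Labels ns → Pred (U ns) ℓ → Set ℓ
StronglyShatters []ₐ            S = S []ₐ
StronglyShatters ((k , c) ∷ₐ L) S =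
  ∃ λ (w : Fin k → Fin _) → (∀ j → c (w j) ≡ j) × StronglyShatters L (λ x → ∀ j → S (w j ∷ₐ x))

LabelAmple : Pred (U ns) ℓ → Set ℓ
LabelAmple S = ∀ L → Shatters L S → StronglyShatters L S

Shatters-mono : {S : Pred (U ns) a} {T : Pred (U ns) b} (L : Labels ns) → S ⊆′ T → Shatters L S → Shatters L T
Shatters-mono []ₐ            S⊆T sh   = S⊆T []ₐ sh
Shatters-mono ((k , c) ∷ₐ L) S⊆T sh j =
  Shatters-mono L (λ x (a , ca≡j , Sax) → a , ca≡j , S⊆T (a ∷ₐ x) Sax) (sh j)

StronglyShatters-mono : {S : Pred (U ns) a} {T : Pred (U ns) b} (L : Labels ns) → S ⊆′ T →
  StronglyShatters L S → StronglyShatters L T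
StronglyShatters-mono []ₐ            S⊆T st             = S⊆T []ₐ st
StronglyShatters-mono ((k , c) ∷ₐ L) S⊆T (w , cw≡ , st) =
  w , cw≡ , StronglyShatters-mono L (λ x Sx j → S⊆T (w j ∷ₐ x) (Sx j)) st

StronglyShatters⇒Shatters : {S : Pred (U ns) ℓ} (L : Labels ns) → StronglyShatters L S → Shatters L S
StronglyShatters⇒Shatters []ₐ            st               = st
StronglyShatters⇒Shatters ((k , c) ∷ₐ L) (w , cw≡ , st) j =
  Shatters-mono L (λ x Sx → w j , cw≡ j , Sx j) (StronglyShatters⇒Shatters L st)

LabelAmple-resp : {S : Pred (U ns) a} {T : Pred (U ns) b} → S ⊆′ T → T ⊆′ S → LabelAmple S → LabelAmple T
LabelAmple-resp S⊆T T⊆S ample L sh = StronglyShatters-mono L S⊆T (ample L (Shatters-mono L T⊆S sh))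

-- Intersection with a condition on one coordinate

module _ {ns : Vec ℕ m} (i : Fin m) (p : Subset (lookup ns i)) (S : Pred (U ns) ℓ) where

  Inside Outside : Pred (U ns) ℓ
  Inside  x = S x × lookupᵃ x i ∈ₛ p
  Outside x = S x × lookupᵃ x i ∉ₛ p

-- With one label left at coordinate `i`, shattering by `Outside` asks only for a point outside `p`
-- over each choice of the other labels.
merge : {ns : Vec ℕ m} → Fin m → Labels ns → Labels ns
merge zero    (_ ∷ₐ L) = (1 , λ _ → zero) ∷ₐ L
merge (suc i) (c ∷ₐ L) = c ∷ₐ merge i L

splitLabel : ∀ {k} → Subset n → (Fin n → Fin k) → Fin n → Fin (suc k)
splitLabel p c a = if does (a ∈ₛ? p) then suc (c a) else zero

splitLabel-∈ : ∀ {k} (p : Subset n) (c : Fin n → Fin k) {a} → a ∈ₛ p → splitLabel p c a ≡ suc (c a)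
splitLabel-∈ p c {a} a∈p with a ∈ₛ? p
... | yes _  = refl
... | no a∉p = contradiction a∈p a∉p

splitLabel-∉ : ∀ {k} (p : Subset n) (c : Fin n → Fin k) {a} → a ∉ₛ p → splitLabel p c a ≡ zero
splitLabel-∉ p c {a} a∉p with a ∈ₛ? p
... | yes a∈p = contradiction a∈p a∉p
... | no _    = refl

splitLabel-suc : ∀ {k} (p : Subset n) (c : Fin n → Fin k) {a j} → splitLabel p c a ≡ suc j → a ∈ₛ p × c a ≡ j
splitLabel-suc p c {a} eq with a ∈ₛ? p
splitLabel-suc p c refl | yes a∈p = a∈p , refl

split : (i : Fin m) → Subset (lookup ns i) → Labels ns → Labels ns
split zero    p ((k , c) ∷ₐ L) = (suc k , splitLabel p c) ∷ₐ L
split (suc i) p (c ∷ₐ L)       = c ∷ₐ split i p L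

-- A copy is a product: either all its elements at coordinate `i` lie in `p`, or a single one
-- outside `p` combines with every choice at the other coordinates.
StronglyShatters⇒Inside⊎Outside : (i : Fin m) (p : Subset (lookup ns i)) {S : Pred (U ns) ℓ} (L : Labels ns) →
  StronglyShatters L S → StronglyShatters L (Inside i p S) ⊎ Shatters (merge i L) (Outside i p S)
StronglyShatters⇒Inside⊎Outside zero p ((k , c) ∷ₐ L) (w , cw≡ , st) with all? (λ j → w j ∈ₛ? p)
... | yes w∈p = inj₁ (w , cw≡ , StronglyShatters-mono L (λ x Sx j → Sx j , w∈p j) st)
... | no w∉p  =
  let j , wj∉p = ¬∀⟶∃¬ _ _ (λ j → w j ∈ₛ? p) w∉p
  in inj₂ λ { zero → Shatters-mono L (λ x Sx → w j , refl , Sx j , wj∉p) (StronglyShatters⇒Shatters L st) }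
StronglyShatters⇒Inside⊎Outside (suc i) p ((k , c) ∷ₐ L) (w , cw≡ , st) =
  [ (λ in′ → inj₁ (w , cw≡ , StronglyShatters-mono L (λ x (Sx , xᵢ∈p) j → Sx j , xᵢ∈p) in′))
  , (λ out → inj₂ λ j → Shatters-mono (merge i L) (λ x (Sx , xᵢ∉p) → w j , cw≡ j , Sx j , xᵢ∉p) out)
  ]′ (StronglyShatters⇒Inside⊎Outside i p L st)

Shatters-split : (i : Fin m) (p : Subset (lookup ns i)) {S : Pred (U ns) ℓ} (L : Labels ns) →
  Shatters L (Inside i p S) → Shatters (merge i L) (Outside i p S) → Shatters (split i p L) S
Shatters-split zero p ((k , c) ∷ₐ L) in′ out zero =
  Shatters-mono L (λ x (a , _ , Sax , a∉p) → a , splitLabel-∉ p c a∉p , Sax) (out zero)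
Shatters-split zero p ((k , c) ∷ₐ L) in′ out (suc j) =
  Shatters-mono L (λ x (a , ca≡j , Sax , a∈p) → a , trans (splitLabel-∈ p c a∈p) (cong suc ca≡j) , Sax) (in′ j)
Shatters-split (suc i) p ((k , c) ∷ₐ L) in′ out j =
  Shatters-split i p L
    (Shatters-mono L (λ x (a , ca≡j , Sax , xᵢ∈p) → (a , ca≡j , Sax) , xᵢ∈p) (in′ j))
    (Shatters-mono (merge i L) (λ x (a , ca≡j , Sax , xᵢ∉p) → (a , ca≡j , Sax) , xᵢ∉p) (out j))

-- Dropping the element chosen for the extra label `zero` leaves elements of `p` only.
StronglyShatters-split : (i : Fin m) (p : Subset (lookup ns i)) {S : Pred (U ns) ℓ} (L : Labels ns) →
  StronglyShatters (split i p L) S → StronglyShatters L (Inside i p S)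
StronglyShatters-split zero p ((k , c) ∷ₐ L) (w , cw≡ , st) =
  w ∘ suc , (λ j → proj₂ (splitLabel-suc p c (cw≡ (suc j)))) ,
  StronglyShatters-mono L (λ x Sx j → Sx (suc j) , proj₁ (splitLabel-suc p c (cw≡ (suc j)))) st
StronglyShatters-split (suc i) p ((k , c) ∷ₐ L) (w , cw≡ , st) =
  w , cw≡ , StronglyShatters-mono L (λ x (Sx , xᵢ∈p) j → Sx j , xᵢ∈p) (StronglyShatters-split i p L st)

-- If a copy in S uses an element outside p, then S also shatters the labelling
-- in which the complement of p is a label of its own.
LabelAmple-Inside : (i : Fin m) (p : Subset (lookup ns i)) {S : Pred (U ns) ℓ} →
  LabelAmple S → LabelAmple (Inside i p S)
LabelAmple-Inside i p ample L sh =
  [ id , (λ out → StronglyShatters-split i p L (ample (split i p L) (Shatters-split i p L sh out))) ]′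
  (StronglyShatters⇒Inside⊎Outside i p L (ample L (Shatters-mono L (λ _ → proj₁) sh)))

-- Restriction to boxes and projection

LabelAmple-∩∏ : (V : Factors ns) {S : Pred (U ns) ℓ} → LabelAmple S → LabelAmple (S ∩ ∏ V)
LabelAmple-∩∏ V {S} ample =
  LabelAmple-resp (λ x (Sx , x∈V) → Sx , λ i → ListAll.lookup x∈V (∈-allFin i))
    (λ x (Sx , x∈V) → Sx , ListAll.tabulate⁺ x∈V) (restrict (allFin _))
  where
  restrict : ∀ is → LabelAmple (λ x → S x × Allₗ (λ i → lookupᵃ x i ∈ₛ lookupᵃ V i) is)
  restrict []       = LabelAmple-resp (λ _ Sx → Sx , []) (λ _ → proj₁) ample
  restrict (i ∷ is) = LabelAmple-resp
    (λ _ ((Sx , xs) , x) → Sx , x ∷ xs) (λ { _ (Sx , x ∷ xs) → (Sx , xs) , x })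
    (LabelAmple-Inside i (lookupᵃ V i) (restrict is))

-- With one label on the first factor, shattering by `S` amounts to shattering by the projection,
-- and a copy in `S` has a single first coordinate.
LabelAmple-∃ : {S : Pred (U (n ∷ᵥ ns)) ℓ} → LabelAmple S → LabelAmple (λ x → ∃ λ a → S (a ∷ₐ x))
LabelAmple-∃ ample L sh =
  let w , _ , st = ample ((1 , λ _ → zero) ∷ₐ L) (λ { zero → Shatters-mono L (λ x (a , Sax) → a , refl , Sax) sh })
  in StronglyShatters-mono L (λ x Sx → w zero , Sx zero) st

-- The partition of a box into points

record Enumeration (p : Subset n) : Set where
  field
    count : ℕ
    rank  : Fin n → Fin count
    elem  : Fin count → Fin n
    elem∈ : ∀ j → elem j ∈ₛ p
    rank-elem : ∀ j → rank (elem j) ≡ j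
    elem-rank : ∀ {a} → a ∈ₛ p → elem (rank a) ≡ a

open Enumeration

enumerate : (p : Subset n) → Nonempty p → Enumeration p
enumerate (false ∷ᵥ p) (suc b , there b∈p) = let e = enumerate p (b , b∈p) in record
  { count     = count e
  -- Labellings are total, so `zero`, which is outside the subset, borrows the rank of `b` as a
  -- default.
  ; rank      = λ { zero → rank e b ; (suc a) → rank e a }
  ; elem      = suc ∘ elem e
  ; elem∈     = there ∘ elem∈ e
  ; rank-elem = rank-elem e
  ; elem-rank = λ { (there a∈p) → cong suc (elem-rank e a∈p) }
  }
enumerate (true ∷ᵥ p) _ with nonempty? p
... | yes p≠∅ = let e = enumerate p p≠∅ in record
  { count     = suc (count e)
  ; rank      = λ { zero → zero ; (suc a) → suc (rank e a) }
  ; elem      = λ { zero → zero ; (suc j) → suc (elem e j) }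
  ; elem∈     = λ { zero → here ; (suc j) → there (elem∈ e j) }
  ; rank-elem = λ { zero → refl ; (suc j) → cong suc (rank-elem e j) }
  ; elem-rank = λ { here → refl ; (there a∈p) → cong suc (elem-rank e a∈p) }
  }
... | no p≡∅ = record
  { count     = 1
  ; rank      = λ _ → zero
  ; elem      = λ _ → zero
  ; elem∈     = λ _ → here
  ; rank-elem = λ { zero → refl }
  ; elem-rank = λ { here → refl ; (there a∈p) → contradiction (_ , a∈p) p≡∅ }
  }

rankLabels : (B : Factors ns) → IsBox B → Labels ns
rankLabels []ₐ      box = []ₐ
rankLabels (p ∷ₐ B) box = let e = enumerate p (box zero) in (count e , rank e) ∷ₐ rankLabels B (box ∘ suc)

∏-∷ : {p : Subset n} {B : Factors ns} {a : Fin n} {x : U ns} → a ∈ₛ p → ∏ B x → ∏ (p ∷ₐ B) (a ∷ₐ x)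
∏-∷ a∈p x∈B zero    = a∈p
∏-∷ a∈p x∈B (suc i) = x∈B i

Shatters-rankLabels : {R : Pred (U ns) ℓ} (B : Factors ns) (box : IsBox B) → ∏ B ⊆′ R → Shatters (rankLabels B box) R
Shatters-rankLabels []ₐ      box B⊆R   = B⊆R []ₐ λ ()
Shatters-rankLabels (p ∷ₐ B) box B⊆R j =
  let e = enumerate p (box zero) in
  Shatters-rankLabels B (box ∘ suc) λ x x∈B →
    elem e j , rank-elem e j , B⊆R _ (∏-∷ (elem∈ e j) x∈B)

-- Within `B` each rank belongs to exactly one element of the factor, so the only possible copy is
-- `B` itself.
StronglyShatters-rankLabels : {R : Pred (U ns) ℓ} (B : Factors ns) (box : IsBox B) → R ⊆′ ∏ B →
  StronglyShatters (rankLabels B box) R → ∏ B ⊆′ R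
StronglyShatters-rankLabels []ₐ      box R⊆B st []ₐ _ = st
StronglyShatters-rankLabels {R = R} (p ∷ₐ B) box R⊆B (w , rw≡ , st) (a ∷ₐ x) x∈B =
  subst (λ a → R (a ∷ₐ x)) wa≡a Rwx
  where
  e   = enumerate p (box zero)
  Rwx : R (w (rank e a) ∷ₐ x)
  Rwx = StronglyShatters-rankLabels B (box ∘ suc) (λ y Ry → R⊆B _ (Ry (rank e a)) ∘ suc) st x (x∈B ∘ suc) (rank e a)
  wa≡a : w (rank e a) ≡ a
  wa≡a = trans (sym (elem-rank e (R⊆B _ Rwx zero)))
    (trans (cong (elem e) (rw≡ (rank e a))) (elem-rank e (x∈B zero)))

-- One label on the first factor forces a common `a`; intersecting with `⊤ ∷ₐ B` forces the rest of
-- the copy to be all of `B`.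
box-in-slice : {T : Pred (U (n ∷ᵥ ns)) ℓ} → LabelAmple T → (B : Factors ns) → IsBox B →
  (∀ x → ∏ B x → ∃ λ a → T (a ∷ₐ x)) → ∃ λ a → ∀ x → ∏ B x → T (a ∷ₐ x)
box-in-slice {T = T} ample B box B⊆T =
  let w , _ , st = LabelAmple-∩∏ (⊤ ∷ₐ B) ample ((1 , λ _ → zero) ∷ₐ rankLabels B box)
        (λ { zero → Shatters-rankLabels B box λ x x∈B →
               let a , Tax = B⊆T x x∈B in a , refl , Tax , ∏-∷ ∈⊤ x∈B })
  in w zero , λ x x∈B →
    proj₁ (StronglyShatters-rankLabels B box (λ y Ty → proj₂ (Ty zero) ∘ suc) st x x∈B zero)

-- Signed counts of subsets

σ : Subset n → ℤ
σ p = ⟦ nonempty? p ⟧ * -1ℤ ^ (∣ p ∣ ∸ 1)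

wt-∷ : (p : Subset n) (B : Factors ns) → wt (p ∷ₐ B) ≡ wt B * σ p
wt-∷ p B = trans
  (cong₂ _*_
    (⟦⟧-× (nonempty? p) (isBox? B) (isBox? (p ∷ₐ B)) (λ box → box zero , box ∘ suc)
      (λ { p≠∅ box zero → p≠∅ ; p≠∅ box (suc i) → box i }))
    (^-distribˡ-+-* -1ℤ (∣ p ∣ ∸ 1) (dim B)))
  (rearrange ⟦ nonempty? p ⟧ ⟦ isBox? B ⟧ (-1ℤ ^ (∣ p ∣ ∸ 1)) (-1ℤ ^ dim B))
  where
  rearrange : ∀ x y z t → x * y * (z * t) ≡ y * t * (x * z)
  rearrange = solve-∀

∑-subsets : ∀ n (g : Subset (suc n) → ℤ) →
  ∑ (subsets (suc n)) g ≡ ∑ (subsets n) (g ∘ (true ∷ᵥ_)) + ∑ (subsets n) (g ∘ (false ∷ᵥ_))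
∑-subsets n g = trans (∑-cartesianProductWith g _∷ᵥ_ (true ∷ false ∷ []) (subsets n))
  (cong (∑ (subsets n) (g ∘ (true ∷ᵥ_)) +_) (+-identityʳ _))

true∷⊈false∷ : (p A : Subset n) → ⟦ (true ∷ᵥ p) ⊆? (false ∷ᵥ A) ⟧ ≡ 0ℤ
true∷⊈false∷ p A = ⟦⟧-no ((true ∷ᵥ p) ⊆? (false ∷ᵥ A)) λ p⊆A → case p⊆A here of λ ()

true∷⊆true∷ : (p A : Subset n) → ⟦ (true ∷ᵥ p) ⊆? (true ∷ᵥ A) ⟧ ≡ ⟦ p ⊆? A ⟧
true∷⊆true∷ p A = ⟦⟧-cong ((true ∷ᵥ p) ⊆? (true ∷ᵥ A)) (p ⊆? A) drop-∷-⊆ s⊆s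

false∷⊆ : ∀ b (p A : Subset n) → ⟦ (false ∷ᵥ p) ⊆? (b ∷ᵥ A) ⟧ ≡ ⟦ p ⊆? A ⟧
false∷⊆ b p A = ⟦⟧-cong ((false ∷ᵥ p) ⊆? (b ∷ᵥ A)) (p ⊆? A) drop-∷-⊆ out⊆

nonempty-false∷ : (A : Subset n) → ⟦ nonempty? (false ∷ᵥ A) ⟧ ≡ ⟦ nonempty? A ⟧
nonempty-false∷ A = ⟦⟧-cong (nonempty? (false ∷ᵥ A)) (nonempty? A)
  (λ { (suc i , there i∈A) → i , i∈A }) (λ (i , i∈A) → suc i , there i∈A)

nonempty-true∷ : (A : Subset n) → ⟦ nonempty? (true ∷ᵥ A) ⟧ ≡ 1ℤ
nonempty-true∷ A = ⟦⟧-yes (nonempty? (true ∷ᵥ A)) (zero , here)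

-- The empty subset counts here. Adding or removing a fixed element of `A` flips the sign, so all
-- cancels unless `A` is empty.
∑-alternating : (A : Subset n) → ∑ (subsets n) (λ p → -1ℤ ^ ∣ p ∣ * ⟦ p ⊆? A ⟧) ≡ 1ℤ - ⟦ nonempty? A ⟧
∑-alternating               []ᵥ          = refl
∑-alternating {n = suc n} A′@(false ∷ᵥ A) = begin
  ∑ (subsets (suc n)) (λ p → -1ℤ ^ ∣ p ∣ * ⟦ p ⊆? A′ ⟧)
    ≡⟨ ∑-subsets n _ ⟩
  ∑ (subsets n) (λ p → -1ℤ ^ suc ∣ p ∣ * ⟦ (true ∷ᵥ p) ⊆? A′ ⟧) + ∑ (subsets n) (λ p → -1ℤ ^ ∣ p ∣ * ⟦ (false ∷ᵥ p) ⊆? A′ ⟧)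
    ≡⟨ cong₂ _+_
         (∑-zero (subsets n) λ p → trans (cong (-1ℤ ^ suc ∣ p ∣ *_) (true∷⊈false∷ p A)) (*-zeroʳ (-1ℤ ^ suc ∣ p ∣)))
         (∑-cong (subsets n) λ p → cong (-1ℤ ^ ∣ p ∣ *_) (false∷⊆ false p A)) ⟩
  0ℤ + ∑ (subsets n) (λ p → -1ℤ ^ ∣ p ∣ * ⟦ p ⊆? A ⟧)
    ≡⟨ trans (+-identityˡ _) (∑-alternating A) ⟩
  1ℤ - ⟦ nonempty? A ⟧
    ≡⟨ cong (λ z → 1ℤ - z) (nonempty-false∷ A) ⟨
  1ℤ - ⟦ nonempty? A′ ⟧ ∎
∑-alternating {n = suc n} A′@(true ∷ᵥ A) = begin
  ∑ (subsets (suc n)) (λ p → -1ℤ ^ ∣ p ∣ * ⟦ p ⊆? A′ ⟧)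
    ≡⟨ ∑-subsets n _ ⟩
  ∑ (subsets n) (λ p → -1ℤ ^ suc ∣ p ∣ * ⟦ (true ∷ᵥ p) ⊆? A′ ⟧) + ∑ (subsets n) (λ p → -1ℤ ^ ∣ p ∣ * ⟦ (false ∷ᵥ p) ⊆? A′ ⟧)
    ≡⟨ cong₂ _+_
         (∑-cong (subsets n) λ p → trans (cong (-1ℤ ^ suc ∣ p ∣ *_) (true∷⊆true∷ p A))
           (*-assoc -1ℤ (-1ℤ ^ ∣ p ∣) ⟦ p ⊆? A ⟧))
         (∑-cong (subsets n) λ p → cong (-1ℤ ^ ∣ p ∣ *_) (false∷⊆ true p A)) ⟩
  ∑ (subsets n) (λ p → -1ℤ * (-1ℤ ^ ∣ p ∣ * ⟦ p ⊆? A ⟧)) + E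
    ≡⟨ cong (_+ E) (trans (∑-*ˡ -1ℤ _ (subsets n)) (-1*i≡-i E)) ⟩
  - E + E
    ≡⟨ +-inverseˡ E ⟩
  0ℤ
    ≡⟨ cong (λ z → 1ℤ - z) (nonempty-true∷ A) ⟨
  1ℤ - ⟦ nonempty? A′ ⟧ ∎
  where
  E = ∑ (subsets n) (λ p → -1ℤ ^ ∣ p ∣ * ⟦ p ⊆? A ⟧)

-- For subsets with the first element, the exponent `∣ true ∷ᵥ p ∣ ∸ 1` is `∣ p ∣`, so
-- `∑-alternating` evaluates their part; the others are left to the induction.
∑-σ : (A : Subset n) → ∑ (subsets n) (λ p → σ p * ⟦ p ⊆? A ⟧) ≡ ⟦ nonempty? A ⟧
∑-σ               []ᵥ       = refl
∑-σ {n = suc n} A′@(b ∷ᵥ A) = trans (∑-subsets n _) (trans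
  (cong₂ _+_
    (∑-cong (subsets n) λ p → cong (_* ⟦ (true ∷ᵥ p) ⊆? A′ ⟧)
      (trans (cong (_* -1ℤ ^ ∣ p ∣) (nonempty-true∷ p)) (*-identityˡ (-1ℤ ^ ∣ p ∣))))
    (trans (∑-cong (subsets n) λ p → cong₂ _*_ (cong (_* -1ℤ ^ (∣ p ∣ ∸ 1)) (nonempty-false∷ p)) (false∷⊆ b p A)) (∑-σ A)))
  (rest b))
  where
  rest : ∀ b → ∑ (subsets n) (λ p → -1ℤ ^ ∣ p ∣ * ⟦ (true ∷ᵥ p) ⊆? (b ∷ᵥ A) ⟧) + ⟦ nonempty? A ⟧ ≡ ⟦ nonempty? (b ∷ᵥ A) ⟧
  rest false = trans (cong (_+ ⟦ nonempty? A ⟧)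
      (∑-zero (subsets n) λ p → trans (cong (-1ℤ ^ ∣ p ∣ *_) (true∷⊈false∷ p A)) (*-zeroʳ (-1ℤ ^ ∣ p ∣))))
    (trans (+-identityˡ ⟦ nonempty? A ⟧) (sym (nonempty-false∷ A)))
  rest true = trans (cong (_+ ⟦ nonempty? A ⟧) (trans
      (∑-cong (subsets n) λ p → cong (-1ℤ ^ ∣ p ∣ *_) (true∷⊆true∷ p A)) (∑-alternating A)))
    (trans (cancel 1ℤ ⟦ nonempty? A ⟧) (sym (nonempty-true∷ A)))
    where
    cancel : ∀ x y → x - y + y ≡ x
    cancel = solve-∀

-- Ampleness implies Euler characteristic 1

LabelAmple⇒∑≡1 : {T : Pred (U ns) ℓ} (T? : Decidable T) → LabelAmple T → Satisfiable T →
  ∑ (allFactors ns) (λ B → wt B * ⟦ ∏⊆? T? B ⟧) ≡ 1ℤ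
LabelAmple⇒∑≡1 {ns = []ᵥ} T? ample ([]ₐ , T[]) =
  cong (λ z → 1ℤ * z + 0ℤ) (⟦⟧-yes (∏⊆? T? []ₐ) λ { []ₐ _ → T[] })
LabelAmple⇒∑≡1 {ns = n ∷ᵥ ns} {T = T} T? ample (a₀ ∷ₐ x₀ , Tx₀) = begin
  ∑ (allFactors (n ∷ᵥ ns)) (λ B → wt B * ⟦ ∏⊆? T? B ⟧)
    ≡⟨ ∑-cartesianProductWith _ _∷ₐ_ (subsets n) (allFactors ns) ⟩
  ∑ (subsets n) (λ p → ∑ (allFactors ns) (λ B → wt (p ∷ₐ B) * ⟦ ∏⊆? T? (p ∷ₐ B) ⟧))
    ≡⟨ ∑-swap (λ p B → wt (p ∷ₐ B) * ⟦ ∏⊆? T? (p ∷ₐ B) ⟧) (subsets n) (allFactors ns) ⟩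
  ∑ (allFactors ns) (λ B → ∑ (subsets n) (λ p → wt (p ∷ₐ B) * ⟦ ∏⊆? T? (p ∷ₐ B) ⟧))
    ≡⟨ ∑-cong (allFactors ns) sum-over-first-factor ⟩
  ∑ (allFactors ns) (λ B → wt B * ⟦ ∏⊆? T′? B ⟧)
    ≡⟨ LabelAmple⇒∑≡1 T′? (LabelAmple-∃ ample) (x₀ , a₀ , Tx₀) ⟩
  1ℤ ∎
  where
  T′? : Decidable (λ x → ∃ λ a → T (a ∷ₐ x))
  T′? x = any? (λ a → T? (a ∷ₐ x))

  module _ (B : Factors ns) where

    slice? : Decidable (λ a → ∏ B ⊆′ λ x → T (a ∷ₐ x))
    slice? a = ∏⊆? (λ x → T? (a ∷ₐ x)) B

    slices : Subset n
    slices = comprehension slice?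

    ∏⊆T⇔⊆slices : ∀ p → ⟦ ∏⊆? T? (p ∷ₐ B) ⟧ ≡ ⟦ p ⊆? slices ⟧
    ∏⊆T⇔⊆slices p = ⟦⟧-cong (∏⊆? T? (p ∷ₐ B)) (p ⊆? slices)
      (λ ⊆T {a} a∈p → ∈-comprehension⁺ slice? λ x x∈B → ⊆T (a ∷ₐ x) (∏-∷ a∈p x∈B))
      (λ { p⊆slices (a ∷ₐ x) x∈ → ∈-comprehension⁻ slice? (p⊆slices (x∈ zero)) x (x∈ ∘ suc) })

    sum-over-first-factor :
      ∑ (subsets n) (λ p → wt (p ∷ₐ B) * ⟦ ∏⊆? T? (p ∷ₐ B) ⟧) ≡ wt B * ⟦ ∏⊆? T′? B ⟧
    sum-over-first-factor = begin
      ∑ (subsets n) (λ p → wt (p ∷ₐ B) * ⟦ ∏⊆? T? (p ∷ₐ B) ⟧)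
        ≡⟨ ∑-cong (subsets n) (λ p → trans (cong₂ _*_ (wt-∷ p B) (∏⊆T⇔⊆slices p)) (*-assoc (wt B) (σ p) _)) ⟩
      ∑ (subsets n) (λ p → wt B * (σ p * ⟦ p ⊆? slices ⟧))
        ≡⟨ ∑-*ˡ (wt B) (λ p → σ p * ⟦ p ⊆? slices ⟧) (subsets n) ⟩
      wt B * ∑ (subsets n) (λ p → σ p * ⟦ p ⊆? slices ⟧)
        -- The signed count is 1 exactly when some slice contains `B`, and `box-in-slice` identifies
        -- this with `B` lying in the projection.
        ≡⟨ wt-cong B (λ box → trans (∑-σ slices) (⟦⟧-cong (nonempty? slices) (∏⊆? T′? B)
             (λ (a , a∈slices) x x∈B → a , ∈-comprehension⁻ slice? a∈slices x x∈B)
             (λ B⊆T′ → let a , B⊆Tₐ = box-in-slice ample B box B⊆T′ in a , ∈-comprehension⁺ slice? B⊆Tₐ))) ⟩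
      wt B * ⟦ ∏⊆? T′? B ⟧ ∎

-- From labellings back to partitions

Surjective : Labels ns → Set
Surjective []ₐ            = Unit
Surjective ((k , c) ∷ₐ L) = (∀ j → ∃ λ a → c a ≡ j) × Surjective L

Shatters⇒Satisfiable : {S : Pred (U ns) ℓ} (L : Labels ns) → U ns → Shatters L S → Satisfiable S
Shatters⇒Satisfiable []ₐ            _        sh = []ₐ , sh
Shatters⇒Satisfiable ((k , c) ∷ₐ L) (a ∷ₐ x) sh =
  let y , b , _ , Sby = Shatters⇒Satisfiable L x (sh (c a)) in b ∷ₐ y , Sby

-- Reaching a label in one coordinate requires labels in the others; those of the given point serve.
-- Over an empty product a labelling without labels could be shattered vacuously.
Shatters⇒Surjective : {S : Pred (U ns) ℓ} (L : Labels ns) → U ns → Shatters L S → Surjective L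
Shatters⇒Surjective []ₐ            _        sh = tt
Shatters⇒Surjective ((k , c) ∷ₐ L) (a ∷ₐ x) sh =
  (λ j → let _ , b , cb≡j , _ = Shatters⇒Satisfiable L x (sh j) in b , cb≡j) ,
  Shatters⇒Surjective L x (sh (c a))

module _ {k} (c : Fin n → Fin k) where

  fibre : Fin k → Subset n
  fibre j = comprehension (λ a → c a ≟ᶠ j)

  ∈-fibre⁺ : ∀ {a j} → c a ≡ j → a ∈ₛ fibre j
  ∈-fibre⁺ {j = j} = ∈-comprehension⁺ (λ a → c a ≟ᶠ j)

  ∈-fibre⁻ : ∀ {a j} → a ∈ₛ fibre j → c a ≡ j
  ∈-fibre⁻ {j = j} = ∈-comprehension⁻ (λ a → c a ≟ᶠ j)

  fibres : (∀ j → ∃ λ a → c a ≡ j) → Partition n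
  fibres surj = record
    { size     = k
    ; block    = fibre
    ; nonempty = λ j → let a , ca≡j = surj j in a , ∈-fibre⁺ ca≡j
    ; covers   = λ a → c a , ∈-fibre⁺ refl , ∈-fibre⁻
    }

partitions : (L : Labels ns) → Surjective L → GeneralizedPartition ns
partitions []ₐ            _           = []ₐ
partitions ((k , c) ∷ₐ L) (surj , sL) = fibres c surj ∷ₐ partitions L sL

Shatters⇒Shattered : {S : Pred (U ns) ℓ} (L : Labels ns) (sL : Surjective L) →
  Shatters L S → Shattered (partitions L sL) S
Shatters⇒Shattered []ₐ            _           sh P = []ₐ , sh , λ ()
Shatters⇒Shattered ((k , c) ∷ₐ L) (surj , sL) sh P =
  let x , (a , ca≡ , Sax) , x∈cell = Shatters⇒Shattered L sL (sh (P zero)) (P ∘ suc)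
  in a ∷ₐ x , Sax , λ { zero → ∈-fibre⁺ c ca≡ ; (suc i) → x∈cell i }

StronglyShattered⇒StronglyShatters : {S : Pred (U ns) ℓ} (L : Labels ns) (sL : Surjective L) →
  StronglyShattered (partitions L sL) S → StronglyShatters L S
StronglyShattered⇒StronglyShatters []ₐ            _           (W , _ , W⊆S) = W⊆S []ₐ λ ()
StronglyShattered⇒StronglyShatters ((k , c) ∷ₐ L) (surj , sL) (p ∷ₐ W , copy , W⊆S) =
  (λ j → proj₁ (copy zero j)) ,
  (λ j → ∈-fibre⁻ c (proj₁ (proj₁ (proj₂ (copy zero j))))) ,
  StronglyShattered⇒StronglyShatters L sL
    (W , copy ∘ suc , λ x x∈W j → W⊆S _ (∏-∷ (proj₂ (proj₁ (proj₂ (copy zero j)))) x∈W))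

Ample⇒LabelAmple : {S : Pred (U ns) ℓ} → U ns → Ample S → LabelAmple S
Ample⇒LabelAmple x ample L sh =
  let sL = Shatters⇒Surjective L x sh
  in StronglyShattered⇒StronglyShatters L sL (ample (partitions L sL) (Shatters⇒Shattered L sL sh))

Ample⇒χ≡1 : {S : Pred (U ns) ℓ} (S? : Decidable S) → Ample S →
  (V : Factors ns) → Satisfiable (S ∩ ∏ V) → χ (S? ∩? ∏? V) ≡ 1ℤ
Ample⇒χ≡1 S? ample V sat@(x , _) =
  trans (χ≡∑ (S? ∩? ∏? V)) (LabelAmple⇒∑≡1 (S? ∩? ∏? V) (LabelAmple-∩∏ V (Ample⇒LabelAmple x ample)) sat)

theorem5 : ∀ {ℓ} (m : ℕ) (ns : Vec ℕ m) → (∀ i → NonZero (lookup ns i)) → (S : Pred (U ns) ℓ) (S? : Decidable S) →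
    Ample S ⇔ ((V : Factors ns) → IsBox V → Satisfiable (S ∩ ∏ V) → χ (S? ∩? ∏? V) ≡ 1ℤ)
theorem5 m ns nonZero S S? = mk⇔ (λ ample V _ → Ample⇒χ≡1 S? ample V) (χ≡1⇒Ample nonZero S?)
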